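{- The odd positive integers $n$ and $n+2$ are twin primes if and only if $$\prod_{\substack{p\mid n(n+2)\\ p\text{ odd}}}\left(1-\frac{1}{p^2}\right)^{ -1}=\frac{n^2(n+2)^2}{(n-1)(n+1)^2(n+3)}.$$
   Context: Twin primes are pairs of primes whose difference is $2$, so $n$ and $n+2$ are twin primes when both are prime. The product is taken over the odd prime divisors $p$ of $n(n+2)$. -}

module Defs where

open import Algebra.Properties.Group using (x∙y⁻¹≈ε⇒x≈y)
open import Data.Integer using (+_)
open import Data.List using (foldr; upTo)
open import Data.List.Relation.Unary.All using (reduce)
open import Data.List.Relation.Unary.All.Properties using (all-filter)
open import Data.Nat using (ℕ; suc; _^_; NonZero; NonTrivial; nonTrivial⇒nonZero; nonTrivial⇒≢1)
open import Data.Nat.Divisibility using (_∣_; _∤_; _∣?_)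
open import Data.Nat.Primality using (Prime; prime?; prime⇒nonTrivial)
open import Data.Nat.Properties using (m^n≢0; m*n≡1⇒m≡1; *-identityˡ)
open import Data.Product using (_×_; _,_)
open import Data.Rational using (ℚ; 0ℚ; 1ℚ; _/_; _-_; _*_; 1/_; ≢-nonZero)
import Data.Rational as ℚ
open import Data.Rational.Properties using (normalize-injective-≃; +-0-group)
open import Function using (_∘_)
open import Relation.Binary.PropositionalEquality using (_≡_; _≢_; sym; trans)
open import Relation.Nullary.Decidable using (_×-dec_; ¬?)
open import Relation.Unary using (Decidable)

Odd : ℕ → Set
Odd n = 2 ∤ n

OddPrimeDivisor : ℕ → ℕ → Set
OddPrimeDivisor m p = Prime p × p ∣ m × Odd p

oddPrimeDivisor? : ∀ m → Decidable (OddPrimeDivisor m)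
oddPrimeDivisor? m p = prime? p ×-dec (p ∣? m) ×-dec ¬? (2 ∣? p)

1/d≡1⇒d≡1 : ∀ d .{{_ : NonZero d}} → 1ℚ ≡ + 1 / d → d ≡ 1
1/d≡1⇒d≡1 d@(suc _) eq = trans (sym (*-identityˡ d)) (normalize-injective-≃ 1 1 1 d eq)

1-1/d≢0 : ∀ d .{{_ : NonZero d}} → d ≢ 1 → ℚ.NonZero (1ℚ - + 1 / d)
1-1/d≢0 d d≢1 = ≢-nonZero (d≢1 ∘ 1/d≡1⇒d≡1 d ∘ x∙y⁻¹≈ε⇒x≈y +-0-group 1ℚ (+ 1 / d))

eulerFactor : (p : ℕ) .{{_ : NonTrivial p}} → ℚ
eulerFactor p = 1/ (1ℚ - + 1 / (p ^ 2))
  where instance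
    p²≢0 : NonZero (p ^ 2)
    p²≢0 = m^n≢0 p 2 {{nonTrivial⇒nonZero p}}
    factor≢0 : ℚ.NonZero (1ℚ - + 1 / (p ^ 2))
    factor≢0 = 1-1/d≢0 (p ^ 2) (nonTrivial⇒≢1 ∘ m*n≡1⇒m≡1 p (p ^ 1))

-- The product over odd primes p ∣ m of (1 - 1/p²)⁻¹, for m > 0.
-- Every divisor of a positive m is at most m, so searching 0, …, m finds
-- each odd prime divisor exactly once.
oddEulerProduct : ℕ → ℚ
oddEulerProduct m =
  foldr _*_ 1ℚ
    (reduce (λ {p} (pr , _) → eulerFactor p {{prime⇒nonTrivial pr}})
      (all-filter (oddPrimeDivisor? m) (upTo (suc m))))

{-# OPTIONS --safe #-}
module Submission where

-- Write F(m) = (1 - 1/m²)⁻¹ = m²/(m² - 1), which is strictly decreasing for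
-- m > 1 and larger than 1. The right-hand side is F(n) F(n + 2). As n is odd,
-- n and n + 2 are coprime, so if p and q are primes dividing n and n + 2, then
-- p ≠ q and the product is at least F(p) F(q) ≥ F(n) F(n + 2). Equality forces
-- p = n and q = n + 2; conversely, if n and n + 2 are prime, then they are the
-- only prime divisors of n (n + 2).

open import Defs
open import Data.Bool using (true; false)
open import Data.Integer using (+_)
import Data.Integer as ℤ
import Data.Integer.Properties as ℤ
open import Data.List using (List; []; _∷_; _++_; foldr; map; filter; upTo)
open import Data.List.Membership.Propositional using (_∈_)
open import Data.List.Membership.Propositional.Properties using (∈-∃++; ∈-filter⁺; ∈-filter⁻; ∈-upTo⁺)
open import Data.List.Relation.Binary.Permutation.Propositional using (_↭_; ↭⇒↭ₛ; ↭-trans; ↭-sym; prep)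
open import Data.List.Relation.Binary.Permutation.Propositional.Properties using (shift; map⁺; ∈-resp-↭)
import Data.List.Relation.Binary.Permutation.Setoid.Properties as Setoid↭
open import Data.List.Relation.Unary.All using (_∷_; reduce)
open import Data.List.Relation.Unary.All.Properties using (all-filter)
open import Data.List.Relation.Unary.AllPairs using (_∷_)
open import Data.List.Relation.Unary.Any using (here; there)
open import Data.List.Relation.Unary.Unique.Propositional using (Unique)
open import Data.List.Relation.Unary.Unique.Propositional.Properties using (upTo⁺; filter⁺)
open import Data.Nat using (ℕ; zero; suc; 2+; _+_; _∸_; _*_; _^_; _≤_; _<_; s≤s; z≤n; NonZero; NonTrivial; >-nonZero; nonTrivial⇒n>1)
open import Data.Nat.Divisibility using (_∣_; ∣-refl; ∣-trans; ∣⇒≤; ∣m+n∣m⇒∣n; ∣m⇒∣m*n; ∣n⇒∣m*n; m∣m*n)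
open import Data.Nat.Primality using (Prime; prime⇒nonTrivial; prime⇒irreducible; euclidsLemma; prime[2]; ¬prime[1])
open import Data.Nat.Primality.Factorisation using (factorise)
import Data.Nat.Properties as ℕ
open import Data.Nat.Tactic.RingSolver using (solve-∀)
open import Data.Product using (_×_; Σ-syntax; ∃; _,_; proj₁; proj₂)
open import Data.Rational using (ℚ; 1ℚ; _/_; _-_; 1/_; toℚᵘ; Positive; NonNegative)
import Data.Rational as ℚ
import Data.Rational.Properties as ℚ
open import Data.Rational.Unnormalised using (mkℚᵘ; *<*; *≡*)
import Data.Rational.Unnormalised as ℚᵘ
import Data.Rational.Unnormalised.Properties as ℚᵘ
open import Data.Sum using (_⊎_; inj₁; inj₂) renaming (map to map⊎)
open import Function using (_∘_)
open import Function.Bundles using (_⇔_; mk⇔)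
open import Relation.Binary.PropositionalEquality using (_≡_; _≢_; refl; sym; trans; cong; cong₂; subst; subst₂; setoid; module ≡-Reasoning)
open import Relation.Nullary using (¬_; _because_; contradiction; invert)
open import Relation.Unary using (Decidable)

-- Fractions of natural numbers and the value of an Euler factor.

/-mono-< : ∀ a b c d .{{_ : NonZero b}} .{{_ : NonZero d}} →
  a * d < c * b → + a / b ℚ.< + c / d
-- `_/_` divides out a gcd, so the comparison is moved to unnormalised fractions, where it is
-- cross-multiplication.
/-mono-< a b@(suc b-1) c d@(suc d-1) ad<cb = ℚ.toℚᵘ-cancel-< (begin-strict
  toℚᵘ (+ a / b)  ≃⟨ ℚ.toℚᵘ-fromℚᵘ (mkℚᵘ (+ a) b-1) ⟩
  mkℚᵘ (+ a) b-1  <⟨ *<* (subst₂ ℤ._<_ (ℤ.pos-* a d) (ℤ.pos-* c b) (ℤ.+<+ ad<cb)) ⟩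
  mkℚᵘ (+ c) d-1  ≃⟨ ℚ.toℚᵘ-fromℚᵘ (mkℚᵘ (+ c) d-1) ⟨
  toℚᵘ (+ c / d)  ∎)
  where open ℚᵘ.≤-Reasoning

/-*-/ : ∀ a b c d .{{_ : NonZero b}} .{{_ : NonZero d}} .{{_ : NonZero (b * d)}} →
  (+ a / b) ℚ.* (+ c / d) ≡ + (a * c) / (b * d)
/-*-/ a b@(suc b-1) c d@(suc d-1) =
  trans (ℚ.toℚᵘ-injective (begin-equality
    toℚᵘ ((+ a / b) ℚ.* (+ c / d))        ≃⟨ ℚ.toℚᵘ-homo-* (+ a / b) (+ c / d) ⟩
    toℚᵘ (+ a / b) ℚᵘ.* toℚᵘ (+ c / d)    ≃⟨ ℚᵘ.*-cong (ℚ.toℚᵘ-fromℚᵘ (mkℚᵘ (+ a) b-1)) (ℚ.toℚᵘ-fromℚᵘ (mkℚᵘ (+ c) d-1)) ⟩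
    mkℚᵘ (+ a) b-1 ℚᵘ.* mkℚᵘ (+ c) d-1    ≃⟨ ℚ.toℚᵘ-fromℚᵘ (mkℚᵘ (+ a) b-1 ℚᵘ.* mkℚᵘ (+ c) d-1) ⟨
    toℚᵘ ((+ a ℤ.* + c) / (b * d))        ∎))
  (cong (_/ (b * d)) (sym (ℤ.pos-* a c)))
  where open ℚᵘ.≤-Reasoning

n/n≡1 : ∀ n .{{_ : NonZero n}} → + n / n ≡ 1ℚ
n/n≡1 n@(suc n-1) = ℚ.fromℚᵘ-cong {mkℚᵘ (+ n) n-1} {mkℚᵘ (+ 1) 0} (*≡* (ℤ.*-comm (+ n) (+ 1)))

1-1/suc : ∀ k → 1ℚ - + 1 / suc k ≡ + k / suc k
1-1/suc k = ℚ.toℚᵘ-injective (begin-equality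
  toℚᵘ (1ℚ - + 1 / suc k)                       ≃⟨ ℚ.toℚᵘ-homo-+ 1ℚ (ℚ.- (+ 1 / suc k)) ⟩
  ℚᵘ.1ℚᵘ ℚᵘ.+ toℚᵘ (ℚ.- (+ 1 / suc k))          ≃⟨ ℚᵘ.+-congʳ ℚᵘ.1ℚᵘ (ℚ.toℚᵘ-homo‿- (+ 1 / suc k)) ⟩
  ℚᵘ.1ℚᵘ ℚᵘ.- toℚᵘ (+ 1 / suc k)                ≃⟨ ℚᵘ.+-congʳ ℚᵘ.1ℚᵘ (ℚᵘ.-‿cong (ℚ.toℚᵘ-fromℚᵘ (mkℚᵘ (+ 1) k))) ⟩
  ℚᵘ.1ℚᵘ ℚᵘ.- mkℚᵘ (+ 1) k                      ≃⟨ *≡* (cong₂ (λ x y → + x ℤ.* + y) (ℕ.+-identityʳ k) (cong suc (sym (ℕ.+-identityʳ k)))) ⟩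
  mkℚᵘ (+ k) k                                  ≃⟨ ℚ.toℚᵘ-fromℚᵘ (mkℚᵘ (+ k) k) ⟨
  toℚᵘ (+ k / suc k)                            ∎)
  where open ℚᵘ.≤-Reasoning

-- Since 1/(1 - 1/(d+1)) = (d+1)/d, the Euler factor of p is succRatio (p² - 1).
-- The value at 0 is junk.
succRatio : ℕ → ℚ
succRatio 0         = 1ℚ
succRatio d@(suc _) = + suc d / d

-- Inverses are unique, so it is enough that `y` satisfies `x ℚ.* y ≡ 1ℚ`.
1/[1-1/suc] : ∀ k .{{_ : ℚ.NonZero (1ℚ - + 1 / 2+ k)}} → 1/ (1ℚ - + 1 / 2+ k) ≡ succRatio (suc k)
1/[1-1/suc] k = begin
  1/ x                        ≡⟨ ℚ.*-identityʳ (1/ x) ⟨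
  1/ x ℚ.* 1ℚ                 ≡⟨ cong (1/ x ℚ.*_) xy≡1 ⟨
  1/ x ℚ.* (x ℚ.* y)          ≡⟨ ℚ.*-assoc (1/ x) x y ⟨
  (1/ x ℚ.* x) ℚ.* y          ≡⟨ cong (ℚ._* y) (ℚ.*-inverseˡ x) ⟩
  1ℚ ℚ.* y                    ≡⟨ ℚ.*-identityˡ y ⟩
  y                           ∎
  where
  open ≡-Reasoning
  x = 1ℚ - + 1 / 2+ k
  y = succRatio (suc k)
  xy≡1 : x ℚ.* y ≡ 1ℚ
  xy≡1 = begin
    x ℚ.* y                                   ≡⟨ cong (ℚ._* y) (1-1/suc (suc k)) ⟩
    (+ suc k / 2+ k) ℚ.* y                    ≡⟨ /-*-/ (suc k) (2+ k) (2+ k) (suc k) ⟩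
    + (suc k * 2+ k) / (2+ k * suc k)         ≡⟨ cong (λ i → + i / (2+ k * suc k)) (ℕ.*-comm (suc k) (2+ k)) ⟩
    + (2+ k * suc k) / (2+ k * suc k)         ≡⟨ n/n≡1 (2+ k * suc k) ⟩
    1ℚ                                        ∎

-- Total version of `eulerFactor`: no evidence of nontriviality is needed, so it can be mapped over
-- a plain list. At 0 and 1 it takes the junk value 1.
factor : ℕ → ℚ
factor m = succRatio (m ^ 2 ∸ 1)

eulerFactor≡factor : ∀ p .{{_ : NonTrivial p}} → eulerFactor p ≡ factor p
-- The square reduces to a double successor, so it is `2+ k` for this `k`, and `suc k` is its
-- predecessor.
eulerFactor≡factor (2+ m) = 1/[1-1/suc] ((2+ m) ^ 2 ∸ 2) {{1-1/d≢0 ((2+ m) ^ 2) λ ()}}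

-- Bounds and monotonicity of Euler factors.

1≤succRatio : ∀ d → 1ℚ ℚ.≤ succRatio d
1≤succRatio zero      = ℚ.≤-refl
1≤succRatio d@(suc _) = ℚ.<⇒≤ (/-mono-< 1 1 (suc d) d
  (subst₂ _<_ (sym (ℕ.*-identityˡ d)) (sym (ℕ.*-identityʳ (suc d))) (ℕ.n<1+n d)))

-- The ratio is 1 + 1/d; cross-multiplied, the claim is c + dc < d + cd. The bound `0 < c` keeps
-- away from the junk value at 0.
succRatio-anti-< : ∀ {c d} → 0 < c → c < d → succRatio d ℚ.< succRatio c
succRatio-anti-< {c@(suc _)} {d@(suc _)} _ c<d = /-mono-< (suc d) d (suc c) c
  (ℕ.+-mono-<-≤ c<d (ℕ.≤-reflexive (ℕ.*-comm d c)))

0<m²∸1 : ∀ {m} → 1 < m → 0 < m ^ 2 ∸ 1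
0<m²∸1 1<m = ℕ.∸-monoˡ-< (ℕ.^-monoˡ-< 2 1<m) ℕ.≤-refl

factor-anti-< : ∀ {m n} → 1 < m → m < n → factor n ℚ.< factor m
factor-anti-< {m} 1<m m<n = succRatio-anti-< (0<m²∸1 1<m)
  (ℕ.∸-monoˡ-< (ℕ.^-monoˡ-< 2 m<n) (ℕ.<⇒≤ (ℕ.^-monoˡ-< 2 1<m)))

factor-anti-≤ : ∀ {m n} → 1 < m → m ≤ n → factor n ℚ.≤ factor m
factor-anti-≤ 1<m m≤n with ℕ.m≤n⇒m<n∨m≡n m≤n
... | inj₁ m<n  = ℚ.<⇒≤ (factor-anti-< 1<m m<n)
... | inj₂ refl = ℚ.≤-refl

factor-cancel-≤ : ∀ {m n} → 1 < m → factor m ℚ.≤ factor n → n ≤ m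
factor-cancel-≤ 1<m le = ℕ.≮⇒≥ λ m<n → ℚ.<-irrefl refl (ℚ.<-≤-trans (factor-anti-< 1<m m<n) le)

1≤⇒positive : ∀ {x} → 1ℚ ℚ.≤ x → Positive x
1≤⇒positive 1≤x = ℚ.positive (ℚ.<-≤-trans (ℚ.positive⁻¹ 1ℚ) 1≤x)

factor-positive : ∀ m → Positive (factor m)
factor-positive m = 1≤⇒positive (1≤succRatio (m ^ 2 ∸ 1))

factor-nonNegative : ∀ m → NonNegative (factor m)
factor-nonNegative m = ℚ.pos⇒nonNeg (factor m) {{factor-positive m}}

p≤x*p : ∀ {x} p .{{_ : NonNegative p}} → 1ℚ ℚ.≤ x → p ℚ.≤ x ℚ.* p
p≤x*p {x} p 1≤x = subst (ℚ._≤ x ℚ.* p) (ℚ.*-identityˡ p) (ℚ.*-monoʳ-≤-nonNeg p 1≤x)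

-- From `q ≤ n`, replacing `factor n` by `factor q` only enlarges the right-hand product. Cancelling
-- `factor q` leaves a comparison of single factors.
factor*factor-cancel-≤ : ∀ p q m n → 1 < p → 1 < q → q ≤ n →
  factor p ℚ.* factor q ℚ.≤ factor m ℚ.* factor n → m ≤ p
factor*factor-cancel-≤ p q m n 1<p 1<q q≤n pq≤mn = factor-cancel-≤ 1<p
  (ℚ.*-cancelʳ-≤-pos (factor q) {{factor-positive q}}
    (ℚ.≤-trans pq≤mn (ℚ.*-monoˡ-≤-nonNeg (factor m) {{factor-nonNegative m}} (factor-anti-≤ 1<q q≤n))))

-- The Euler product as a product over a list.

factorProduct : List ℕ → ℚ
factorProduct = foldr ℚ._*_ 1ℚ ∘ map factor

factorProduct-↭ : ∀ {xs ys} → xs ↭ ys → factorProduct xs ≡ factorProduct ys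
factorProduct-↭ xs↭ys =
  Setoid↭.foldr-commMonoid (setoid ℚ) ℚ.*-1-isCommutativeMonoid (↭⇒↭ₛ (map⁺ factor xs↭ys))

1≤factorProduct : ∀ xs → 1ℚ ℚ.≤ factorProduct xs
1≤factorProduct []       = ℚ.≤-refl
1≤factorProduct (x ∷ xs) = ℚ.≤-trans (1≤factorProduct xs)
  (p≤x*p (factorProduct xs) (1≤succRatio (x ^ 2 ∸ 1)))
  where
  instance
    nonNeg : NonNegative (factorProduct xs)
    nonNeg = ℚ.pos⇒nonNeg (factorProduct xs) {{1≤⇒positive (1≤factorProduct xs)}}

-- `oddEulerProduct` folds over primality proofs. As each value depends only on the prime, the
-- proofs can be forgotten and facts about plain lists apply.
reduce-all-filter : ∀ {A B : Set} {P : A → Set} (P? : Decidable P) (f : ∀ {x} → P x → B) (g : A → B) →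
  (∀ {x} (px : P x) → f px ≡ g x) → ∀ xs → reduce f (all-filter P? xs) ≡ map g (filter P? xs)
reduce-all-filter P? f g f≗g []       = refl
reduce-all-filter P? f g f≗g (x ∷ xs) with P? x
... | true  because [px] = cong₂ _∷_ (f≗g (invert [px])) (reduce-all-filter P? f g f≗g xs)
... | false because _    = reduce-all-filter P? f g f≗g xs

oddPrimeDivisors : ℕ → List ℕ
oddPrimeDivisors m = filter (oddPrimeDivisor? m) (upTo (suc m))

oddEulerProduct≡factorProduct : ∀ m → oddEulerProduct m ≡ factorProduct (oddPrimeDivisors m)
oddEulerProduct≡factorProduct m = cong (foldr ℚ._*_ 1ℚ)
  (reduce-all-filter (oddPrimeDivisor? m) _ factor
    (λ {p} (pr , _) → eulerFactor≡factor p {{prime⇒nonTrivial pr}}) (upTo (suc m)))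

∈-oddPrimeDivisors⁺ : ∀ {m p} .{{_ : NonZero m}} → OddPrimeDivisor m p → p ∈ oddPrimeDivisors m
∈-oddPrimeDivisors⁺ {m} d@(_ , p∣m , _) = ∈-filter⁺ (oddPrimeDivisor? m) (∈-upTo⁺ (s≤s (∣⇒≤ p∣m))) d

∈-oddPrimeDivisors⁻ : ∀ {m p} → p ∈ oddPrimeDivisors m → OddPrimeDivisor m p
∈-oddPrimeDivisors⁻ {m} p∈ = proj₂ (∈-filter⁻ (oddPrimeDivisor? m) {xs = upTo (suc m)} p∈)

oddPrimeDivisors-unique : ∀ m → Unique (oddPrimeDivisors m)
oddPrimeDivisors-unique m = filter⁺ (oddPrimeDivisor? m) (upTo⁺ (suc m))

-- Rearranging lists.

∈⇒↭∷ : ∀ {A : Set} {x : A} {xs} → x ∈ xs → ∃ λ ys → xs ↭ x ∷ ys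
∈⇒↭∷ {x = x} x∈xs with ys , zs , refl ← ∈-∃++ x∈xs = ys ++ zs , shift x ys zs

∈∈⇒↭∷∷ : ∀ {A : Set} {x y : A} {xs} → x ∈ xs → y ∈ xs → x ≢ y → ∃ λ zs → xs ↭ x ∷ y ∷ zs
∈∈⇒↭∷∷ {x = x} x∈xs y∈xs x≢y with ys , xs↭ ← ∈⇒↭∷ x∈xs with ∈-resp-↭ xs↭ y∈xs
... | here y≡x   = contradiction (sym y≡x) x≢y
... | there y∈ys with zs , ys↭ ← ∈⇒↭∷ y∈ys = zs , ↭-trans xs↭ (prep x ys↭)

-- With `x` and `y` moved to the front, any third entry would repeat one of them.
unique-pair : ∀ {A : Set} {x y : A} {xs} → Unique xs → (∀ {z} → z ∈ xs → z ≡ x ⊎ z ≡ y) →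
  x ∈ xs → y ∈ xs → x ≢ y → xs ↭ x ∷ y ∷ []
unique-pair {A} u only x∈ y∈ x≢y with ∈∈⇒↭∷∷ x∈ y∈ x≢y
... | []     , xs↭ = xs↭
... | z ∷ zs , xs↭ with Setoid↭.Unique-resp-↭ (setoid A) (↭⇒↭ₛ xs↭) u
                      | only (∈-resp-↭ (↭-sym xs↭) (there (there (here refl))))
...   | (_ ∷ x≢z ∷ _) ∷ _ | inj₁ z≡x = contradiction (sym z≡x) x≢z
...   | _ ∷ (y≢z ∷ _) ∷ _ | inj₂ z≡y = contradiction (sym z≡y) y≢z

-- Prime divisors of `n` and `n + 2`.

prime⇒1< : ∀ {p} → Prime p → 1 < p
prime⇒1< {p} pr = nonTrivial⇒n>1 p {{prime⇒nonTrivial pr}}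

∃prime∣ : ∀ {n} → 1 < n → ∃ λ p → Prime p × p ∣ n
∃prime∣ {n} (s≤s (s≤s _)) with factorise n
-- An empty factor list has product 1, which the match on `1 < n` excludes.
... | record { factors = p ∷ _ ; isFactorisation = eq ; factorsPrime = pr ∷ _ } = p , pr , subst (p ∣_) (sym eq) (m∣m*n _)

prime∣prime⇒≡ : ∀ {p q} → Prime p → Prime q → p ∣ q → p ≡ q
prime∣prime⇒≡ pp pq p∣q with prime⇒irreducible pq p∣q
... | inj₁ refl = contradiction pp ¬prime[1]
... | inj₂ p≡q  = p≡q

odd-∣ : ∀ {m n} → Odd n → m ∣ n → Odd m
odd-∣ odd m∣n 2∣m = odd (∣-trans 2∣m m∣n)

-- A common prime divides the difference 2, so it is 2, but `n` is odd.
prime-∤-both : ∀ {n p} → Odd n → Prime p → p ∣ n → ¬ (p ∣ n + 2)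
prime-∤-both odd pr p∣n p∣n+2 =
  odd (subst (_∣ _) (prime∣prime⇒≡ pr prime[2] (∣m+n∣m⇒∣n p∣n+2 p∣n)) p∣n)

-- Being distinct, `p` and `q` occupy separate entries; the remaining factors multiply to at least
-- 1.
factorProduct-∈∈ : ∀ {p q xs} → p ∈ xs → q ∈ xs → p ≢ q → factor p ℚ.* factor q ℚ.≤ factorProduct xs
factorProduct-∈∈ {p} {q} {xs} p∈xs q∈xs p≢q with zs , xs↭ ← ∈∈⇒↭∷∷ p∈xs q∈xs p≢q = begin
  factor p ℚ.* factor q                              ≡⟨ ℚ.*-identityʳ _ ⟨
  factor p ℚ.* factor q ℚ.* 1ℚ                       ≤⟨ ℚ.*-monoˡ-≤-nonNeg (factor p ℚ.* factor q) (1≤factorProduct zs) ⟩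
  factor p ℚ.* factor q ℚ.* factorProduct zs         ≡⟨ ℚ.*-assoc (factor p) (factor q) _ ⟩
  factor p ℚ.* (factor q ℚ.* factorProduct zs)       ≡⟨ factorProduct-↭ xs↭ ⟨
  factorProduct xs                                   ∎
  where
  open ℚ.≤-Reasoning
  instance
    nonNeg : NonNegative (factor p ℚ.* factor q)
    nonNeg = ℚ.nonNeg*nonNeg⇒nonNeg
      (factor p) {{factor-nonNegative p}} (factor q) {{factor-nonNegative q}}

-- The right-hand side as a product of two factors.

[1+m]²∸1≡m*[2+m] : ∀ m → suc m ^ 2 ∸ 1 ≡ m * (2+ m)
[1+m]²∸1≡m*[2+m] = identity
  where
  -- The left side is what `suc m ^ 2 ∸ 1` reduces to, free of the truncated subtraction so that the
  -- semiring solver applies.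
  identity : ∀ m → m * 1 + m * (1 + m * 1) ≡ m * (2 + m)
  identity = solve-∀

succRatio-* : ∀ a b {x y} .{{_ : NonZero a}} .{{_ : NonZero b}} .{{_ : NonZero y}} →
  x ≡ suc a * suc b → y ≡ a * b → + x / y ≡ succRatio a ℚ.* succRatio b
succRatio-* a@(suc _) b@(suc _) refl refl = sym (/-*-/ (suc a) a (suc b) b)

denominator≢0 : ∀ {n} → 1 < n → NonZero ((n ∸ 1) * (n + 1) ^ 2 * (n + 3))
denominator≢0 (s≤s (s≤s _)) = _

-- At `n = 1` the factor `n ∸ 1` makes the denominator zero.
denominator≢0⇒1< : ∀ {n} → 0 < n → NonZero ((n ∸ 1) * (n + 1) ^ 2 * (n + 3)) → 1 < n
denominator≢0⇒1< {2+ _} _ _ = s≤s (s≤s z≤n)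

-- The two differences of squares are (m - 1)(m + 1) and (m + 1)(m + 3); they share m + 1, whence
-- the square.
[m²∸1]*[[m+2]²∸1] : ∀ m .{{_ : NonZero m}} →
  (m ∸ 1) * (m + 1) ^ 2 * (m + 3) ≡ (m ^ 2 ∸ 1) * ((m + 2) ^ 2 ∸ 1)
[m²∸1]*[[m+2]²∸1] (suc k) =
  trans (identity k) (sym (cong₂ _*_ ([1+m]²∸1≡m*[2+m] k) ([1+m]²∸1≡m*[2+m] (k + 2))))
  where
  identity : ∀ k → k * (((1 + k) + 1) * (((1 + k) + 1) * 1)) * ((1 + k) + 3)
                 ≡ k * (2 + k) * ((k + 2) * (2 + (k + 2)))
  identity = solve-∀

rhs≡factor*factor : ∀ {n} → 1 < n → .{{_ : NonZero ((n ∸ 1) * (n + 1) ^ 2 * (n + 3))}} →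
  + (n ^ 2 * (n + 2) ^ 2) / ((n ∸ 1) * (n + 1) ^ 2 * (n + 3)) ≡ factor n ℚ.* factor (n + 2)
rhs≡factor*factor {n} 1<n = succRatio-* (n ^ 2 ∸ 1) ((n + 2) ^ 2 ∸ 1)
  {{>-nonZero (0<m²∸1 1<n)}} {{>-nonZero (0<m²∸1 1<n+2)}}
  (sym (cong₂ _*_ (1+[m²∸1] 1<n) (1+[m²∸1] 1<n+2)))
  ([m²∸1]*[[m+2]²∸1] n {{>-nonZero (ℕ.<⇒≤ 1<n)}})
  where
  1<n+2 : 1 < n + 2
  1<n+2 = ℕ.<-≤-trans 1<n (ℕ.m≤m+n n 2)
  1+[m²∸1] : ∀ {m} → 1 < m → suc (m ^ 2 ∸ 1) ≡ m ^ 2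
  1+[m²∸1] 1<m = ℕ.m+[n∸m]≡n (ℕ.<⇒≤ (ℕ.^-monoˡ-< 2 1<m))

-- The two directions for `n > 1`.

module _ {n} (odd-n : Odd n) (odd-n+2 : Odd (n + 2)) (1<n : 1 < n) where

  private instance
    n≢0 : NonZero n
    n≢0 = >-nonZero (ℕ.<⇒≤ 1<n)
    n+2≢0 : NonZero (n + 2)
    n+2≢0 = >-nonZero (ℕ.<-≤-trans (ℕ.<⇒≤ 1<n) (ℕ.m≤m+n n 2))
    n[n+2]≢0 : NonZero (n * (n + 2))
    n[n+2]≢0 = ℕ.m*n≢0 n (n + 2)

  ∣n⇒∈ : ∀ {p} → Prime p → p ∣ n → p ∈ oddPrimeDivisors (n * (n + 2))
  ∣n⇒∈ pr p∣n = ∈-oddPrimeDivisors⁺ (pr , ∣m⇒∣m*n (n + 2) p∣n , odd-∣ odd-n p∣n)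

  ∣n+2⇒∈ : ∀ {p} → Prime p → p ∣ n + 2 → p ∈ oddPrimeDivisors (n * (n + 2))
  ∣n+2⇒∈ pr p∣n+2 = ∈-oddPrimeDivisors⁺ (pr , ∣n⇒∣m*n n p∣n+2 , odd-∣ odd-n+2 p∣n+2)

  coprime-factors : ∀ {p q} → Prime p → p ∣ n → q ∣ n + 2 → p ≢ q
  coprime-factors pr p∣n q∣n+2 refl = prime-∤-both odd-n pr p∣n q∣n+2

  primes⇒product : Prime n → Prime (n + 2) → oddEulerProduct (n * (n + 2)) ≡ factor n ℚ.* factor (n + 2)
  primes⇒product pn pn+2 = begin
    oddEulerProduct (n * (n + 2))                     ≡⟨ oddEulerProduct≡factorProduct (n * (n + 2)) ⟩
    factorProduct (oddPrimeDivisors (n * (n + 2)))    ≡⟨ factorProduct-↭ (unique-pair (oddPrimeDivisors-unique (n * (n + 2))) only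
                                                           (∣n⇒∈ pn ∣-refl) (∣n+2⇒∈ pn+2 ∣-refl) (coprime-factors pn ∣-refl ∣-refl)) ⟩
    factor n ℚ.* (factor (n + 2) ℚ.* 1ℚ)              ≡⟨ cong (factor n ℚ.*_) (ℚ.*-identityʳ (factor (n + 2))) ⟩
    factor n ℚ.* factor (n + 2)                       ∎
    where
    open ≡-Reasoning
    only : ∀ {p} → p ∈ oddPrimeDivisors (n * (n + 2)) → p ≡ n ⊎ p ≡ n + 2
    -- Euclid's lemma puts the prime under `n` or `n + 2`, both prime here.
    only p∈ with pr , p∣ , _ ← ∈-oddPrimeDivisors⁻ {n * (n + 2)} p∈ =
      map⊎ (prime∣prime⇒≡ pr pn) (prime∣prime⇒≡ pr pn+2) (euclidsLemma n (n + 2) pr p∣)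

  product⇒primes : oddEulerProduct (n * (n + 2)) ≡ factor n ℚ.* factor (n + 2) → Prime n × Prime (n + 2)
  product⇒primes eq = subst Prime p≡n pr-p , subst Prime q≡n+2 pr-q
    where
    -- Any prime divisors serve: they turn out to equal `n` and `n + 2`, which thereby inherit
    -- primality.
    ∃p = ∃prime∣ 1<n
    ∃q = ∃prime∣ (ℕ.<-≤-trans 1<n (ℕ.m≤m+n n 2))
    p = proj₁ ∃p
    q = proj₁ ∃q
    pr-p = proj₁ (proj₂ ∃p)
    pr-q = proj₁ (proj₂ ∃q)
    p∣n = proj₂ (proj₂ ∃p)
    q∣n+2 = proj₂ (proj₂ ∃q)

    bound : factor p ℚ.* factor q ℚ.≤ factor n ℚ.* factor (n + 2)
    bound = begin
      factor p ℚ.* factor q                             ≤⟨ factorProduct-∈∈ (∣n⇒∈ pr-p p∣n) (∣n+2⇒∈ pr-q q∣n+2)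
                                                              (coprime-factors pr-p p∣n q∣n+2) ⟩
      factorProduct (oddPrimeDivisors (n * (n + 2)))    ≡⟨ oddEulerProduct≡factorProduct (n * (n + 2)) ⟨
      oddEulerProduct (n * (n + 2))                     ≡⟨ eq ⟩
      factor n ℚ.* factor (n + 2)                       ∎
      where open ℚ.≤-Reasoning

    p≤n : p ≤ n
    p≤n = ∣⇒≤ p∣n
    q≤n+2 : q ≤ n + 2
    q≤n+2 = ∣⇒≤ q∣n+2

    p≡n : p ≡ n
    p≡n = ℕ.≤-antisym p≤n
      (factor*factor-cancel-≤ p q n (n + 2) (prime⇒1< pr-p) (prime⇒1< pr-q) q≤n+2 bound)
    q≡n+2 : q ≡ n + 2
    q≡n+2 = ℕ.≤-antisym q≤n+2
      -- The same cancellation with the two primes exchanged, so both products are commuted.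
      (factor*factor-cancel-≤ q p (n + 2) n (prime⇒1< pr-q) (prime⇒1< pr-p) p≤n
        (subst₂ ℚ._≤_ (ℚ.*-comm (factor p) (factor q)) (ℚ.*-comm (factor n) (factor (n + 2))) bound))

corollary3p1 : ∀ (n : ℕ) → 0 < n → Odd n → Odd (n + 2) →
    (Prime n × Prime (n + 2))
      ⇔
    -- For n = 1 the right-hand side is undefined, so the equation includes
    -- the condition that its denominator does not vanish.
    (Σ[ d≢0 ∈ NonZero ((n ∸ 1) * (n + 1) ^ 2 * (n + 3)) ]
      oddEulerProduct (n * (n + 2))
        ≡ _/_ (+ (n ^ 2 * (n + 2) ^ 2)) ((n ∸ 1) * (n + 1) ^ 2 * (n + 3)) {{d≢0}})
corollary3p1 n 0<n odd-n odd-n+2 = mk⇔ to from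
  where
  to : _
  to (pn , pn+2) = denominator≢0 1<n ,
    trans (primes⇒product odd-n odd-n+2 1<n pn pn+2) (sym (rhs≡factor*factor 1<n {{denominator≢0 1<n}}))
    where 1<n = prime⇒1< pn
  from : _
  from (d≢0 , eq) = product⇒primes odd-n odd-n+2 1<n (trans eq (rhs≡factor*factor 1<n {{d≢0}}))
    where 1<n = denominator≢0⇒1< 0<n d≢0
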